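{- Let $\ell\geq 3$ be an integer and let $Z^{(3)- }_\ell$ be the $3$-graph obtained from $Z^{(3)}_\ell$ by deleting one edge. Then $\gamma(Z^{(3)- }_\ell)=0$.
   Context: A $3$-graph $H$ has vertex set $V(H)$ and edge set consisting of $3$-subsets of $V(H)$. The minimum codegree $\delta(H)$ is the minimum, over all pairs $S\subseteq V(H)$, of the number of edges containing $S$. For a $3$-graph $F$, $\mathrm{ex}_{\mathrm{co}}(n,F)$ is the maximum $d$ such that some $n$-vertex $3$-graph with no copy of $F$ has $\delta\geq d$, and $\gamma(F)=\lim_{n\to\infty}\mathrm{ex}_{\mathrm{co}}(n,F)/n$. The zycle $Z^{(3)}_\ell$ is the $3$-graph with vertex set $\{v_i^1,v_i^2: i\in[\ell]\}$ and edges $\{v_i^1,v_i^2,v_{i+1}^j\}$ for $i\in[\ell]$, $j\in\{1,2\}$, with indices modulo $\ell$. -}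

module Defs where

open import Data.Nat using (ℕ; zero; suc; _≤_; _*_)
open import Data.Nat.DivMod using (_%_; m%n<n)
open import Data.Fin using (Fin; toℕ; fromℕ<; zero; suc)
open import Data.Fin.Properties using (_≟_)
open import Data.Bool using (Bool; true; false)
open import Data.Product using (_×_; _,_; Σ)
open import Data.List using (List; length; filter)
open import Data.List.Base using ()
open import Data.Fin.Base using ()
open import Data.List using (allFin)
open import Relation.Nullary using (¬_; Dec; yes; no)
open import Relation.Nullary.Decidable using (_×-dec_; ¬?)
open import Relation.Binary.PropositionalEquality using (_≡_; _≢_)
open import Function.Definitions using (Injective)

-- A 3-graph on vertex set Fin n: an edge indicator on ordered triples that
-- is invariant under permutations of the triple and false on non-distinct triples.
-- So the edges are exactly the 3-subsets {x,y,z} with edge x y z ≡ true.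
record ThreeGraph (n : ℕ) : Set where
  field
    edge     : Fin n → Fin n → Fin n → Bool
    swap₁₂   : ∀ x y z → edge x y z ≡ edge y x z
    swap₂₃   : ∀ x y z → edge x y z ≡ edge x z y
    distinct : ∀ x y z → x ≡ y → edge x y z ≡ false
open ThreeGraph public

codeg : ∀ {n} → ThreeGraph n → Fin n → Fin n → ℕ
codeg {n} H x y =
  length (filter (λ z → ¬? (z ≟ x) ×-dec (¬? (z ≟ y) ×-dec Data.Bool._≟_ (edge H x y z) true)) (allFin n))

MinCodegreeAtLeast : ∀ {n} → ThreeGraph n → ℕ → Set
MinCodegreeAtLeast {n} H d = ∀ (x y : Fin n) → x ≢ y → d ≤ codeg H x y

next : ∀ {ℓ} → Fin ℓ → Fin ℓ
next {suc m} i = fromℕ< (m%n<n (suc (toℕ i)) (suc m))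

-- The zycle Z_ℓ has vertices v_i^j, encoded as (i , j) : Fin ℓ × Fin 2, and edges
-- {v_i^1, v_i^2, v_{i+1}^j}, indexed by (i , j).  Z_ℓ^- deletes the edge with
-- i = first index and j = first index, i.e. {v_1^1, v_1^2, v_2^1}.
ZVertex : ℕ → Set
ZVertex ℓ = Fin ℓ × Fin 2

IsDeletedEdge : ∀ {ℓ} → Fin ℓ → Fin 2 → Set
IsDeletedEdge i j = (toℕ i ≡ 0) × (j ≡ zero)

ContainsZycleMinus : ∀ {n} → (ℓ : ℕ) → ThreeGraph n → Set
ContainsZycleMinus {n} ℓ H =
  Σ (ZVertex ℓ → Fin n) λ φ → Injective _≡_ _≡_ φ ×
    (∀ (i : Fin ℓ) (j : Fin 2) → ¬ IsDeletedEdge i j →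
       edge H (φ (i , zero)) (φ (i , suc zero)) (φ (next i , j)) ≡ true)

{-# OPTIONS --safe #-}
module Submission where

-- Write P → Q for disjoint pairs P, Q such that P ∪ {q} is an edge for each q ∈ Q; a
-- copy of Z_ℓ^- is a walk {z,y} → {c,e} → … → {a,b} of ℓ disjoint pairs for which
-- {a,b,y} is an edge.  Suppose k · d > n.  A bounded set Y, chosen greedily, meets the
-- neighbourhoods of so many pairs {a,b} that every vertex set of linear size contains
-- such a pair.  For each y ∈ Y in turn, averaging gives z_y such that a positive
-- fraction of the current reservoir of vertices lies in the neighbourhood of {y, z_y}; since Y is bounded,
-- two vertices c, e survive to the end, so that {z_y, y} → {c,e} for all y ∈ Y at once.
-- From {c,e} walk along pairs outside the bounded set of vertices used so far, and let
-- the last pair {a,b} be one whose neighbourhood meets Y, in y say.  Then {z_y, y}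
-- closes the walk.

open import Defs
open import Data.Bool using (Bool; true; false; _∧_; _∨_; not)
open import Data.Bool.ListAction using (any)
open import Data.Bool.Properties using (T-≡)
open import Data.Fin using (Fin; zero; suc; toℕ; fromℕ; inject₁)
open import Data.Fin.Properties using (_≟_; toℕ-injective; toℕ-fromℕ; toℕ-fromℕ<; toℕ-inject₁; toℕ<n)
open import Data.Fin.Relation.Unary.Top using (view; ‵fromℕ; ‵inject₁)
open import Data.List using (List; []; _∷_; length; map; filterᵇ; filter; allFin; cartesianProduct; _++_)
import Data.List.Membership.DecPropositional as DecMembership
open import Data.List.Membership.Propositional using (_∈_; _∉_)
open import Data.List.Membership.Propositional.Properties using (∈-map⁺; ∈-map⁻; ∈-++⁺ˡ; ∈-++⁺ʳ)
open import Data.List.Properties using (length-filter; length-tabulate; length-map; length-++; filter-++)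
open import Data.List.Relation.Unary.All as All using (All; []; _∷_)
import Data.List.Relation.Unary.All.Properties as All
open import Data.List.Relation.Unary.AllPairs using ([]; _∷_)
open import Data.List.Relation.Unary.Any using (here; there)
open import Data.List.Relation.Unary.Unique.Propositional using (Unique)
open import Data.List.Relation.Unary.Unique.Propositional.Properties using (allFin⁺)
open import Data.Nat using (ℕ; zero; suc; _+_; _*_; _∸_; _≤_; _<_; z≤n; s≤s)
open import Data.Nat.DivMod using (_%_; m%n<n; n%n≡0; m<n⇒m%n≡m)
open import Data.Nat.ListAction using (sum)
open import Data.Nat.Properties hiding (_≟_)
open import Data.Nat.Tactic.RingSolver using (solve-∀)
open import Data.Product using (∃; ∃₂; _×_; _,_; proj₁; proj₂)
open import Data.Sum using (inj₁; inj₂)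
open import Data.Vec.Functional using () renaming (_∷_ to _∷ᶠ_)
open import Function using (_∘_)
open import Function.Bundles using (Equivalence)
open import Function.Definitions using (Injective)
open import Relation.Binary.PropositionalEquality
open import Relation.Nullary using (¬_; Dec; does; yes; no; contradiction)
open import Relation.Nullary.Decidable using (T?)
open import Relation.Unary using (Decidable)
open import Algebra.Properties.CommutativeSemigroup +-commutativeSemigroup using (x∙yz≈y∙xz)

-- Counting in finite lists.

private
  variable
    A B : Set
    p q : A → Bool

count : (A → Bool) → List A → ℕ
count p xs = length (filterᵇ p xs)

count-mono : (∀ x → p x ≡ true → q x ≡ true) → ∀ xs → count p xs ≤ count q xs
count-mono h [] = z≤n
count-mono {p = p} {q} h (x ∷ xs) with p x in px | q x in qx
... | true  | true  = s≤s (count-mono h xs)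
... | true  | false = contradiction (trans (sym qx) (h x px)) λ ()
... | false | true  = m≤n⇒m≤1+n (count-mono h xs)
... | false | false = count-mono h xs

count-∨ : ∀ (p q : A → Bool) xs → count (λ x → p x ∨ q x) xs ≤ count p xs + count q xs
count-∨ p q [] = z≤n
count-∨ p q (x ∷ xs) with p x | q x
... | true  | true  = s≤s (≤-trans (count-∨ p q xs) (+-monoʳ-≤ (count p xs) (n≤1+n _)))
... | true  | false = s≤s (count-∨ p q xs)
... | false | true  = ≤-trans (s≤s (count-∨ p q xs)) (≤-reflexive (sym (+-suc _ _)))
... | false | false = count-∨ p q xs

count-not : ∀ (p : A → Bool) xs → length xs ≡ count (not ∘ p) xs + count p xs
count-not p [] = refl
count-not p (x ∷ xs) with p x
... | true  = trans (cong suc (count-not p xs)) (sym (+-suc _ _))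
... | false = cong suc (count-not p xs)

count-filterᵇ : ∀ (p q : A → Bool) xs →
  count p (filterᵇ q xs) ≡ count (λ x → q x ∧ p x) xs
count-filterᵇ p q [] = refl
count-filterᵇ p q (x ∷ xs) with q x
... | false = count-filterᵇ p q xs
... | true with p x
...   | true  = cong suc (count-filterᵇ p q xs)
...   | false = count-filterᵇ p q xs

count-<⇒∃ : ∀ (p q : A → Bool) xs → count q xs < count p xs →
  ∃ λ x → p x ≡ true × q x ≡ false
count-<⇒∃ p q (x ∷ xs) lt with p x in px | q x in qx
... | true  | true  = count-<⇒∃ p q xs (≤-pred lt)
... | true  | false = x , px , qx
... | false | true  = count-<⇒∃ p q xs (≤-trans (n≤1+n _) lt)
... | false | false = count-<⇒∃ p q xs lt

-- Bridges `codeg`, which filters by a decidable predicate, and `count`, which filters by a Boolean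
-- test.
length-filter≤count : ∀ {P : A → Set} (P? : Decidable P) (p : A → Bool) →
  (∀ {x} → P x → p x ≡ true) → ∀ xs → length (filter P? xs) ≤ count p xs
length-filter≤count P? p h [] = z≤n
length-filter≤count P? p h (x ∷ xs) with P? x | p x in px
... | yes Px | true  = s≤s (length-filter≤count P? p h xs)
... | yes Px | false = contradiction (trans (sym px) (h Px)) λ ()
... | no  _  | true  = m≤n⇒m≤1+n (length-filter≤count P? p h xs)
... | no  _  | false = length-filter≤count P? p h xs

count-++ : ∀ (p : A → Bool) xs ys → count p (xs ++ ys) ≡ count p xs + count p ys
count-++ p xs ys = trans (cong length (filter-++ (T? ∘ p) xs ys)) (length-++ (filterᵇ p xs))

count-map : ∀ (p : B → Bool) (f : A → B) xs → count p (map f xs) ≡ count (p ∘ f) xs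
count-map p f [] = refl
count-map p f (x ∷ xs) with p (f x)
... | true  = cong suc (count-map p f xs)
... | false = count-map p f xs

-- The product is counted row by row, and rows outside `r` are bounded below by 0. With a
-- neighbourhood as `r`, this yields many ordered pairs inside it.
count-cartesianProduct-≥ : ∀ (p : A × B → Bool) (r : A → Bool) m xs ys →
  (∀ x → r x ≡ true → m ≤ count (λ y → p (x , y)) ys) →
  count r xs * m ≤ count p (cartesianProduct xs ys)
count-cartesianProduct-≥ p r m [] ys h = z≤n
count-cartesianProduct-≥ p r m (x ∷ xs) ys h = ≤-trans head-tail (≤-reflexive (sym split))
  where
    split : count p (cartesianProduct (x ∷ xs) ys)
              ≡ count (λ y → p (x , y)) ys + count p (cartesianProduct xs ys)
    split = trans (count-++ p (map (x ,_) ys) (cartesianProduct xs ys))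
                  (cong (_+ count p (cartesianProduct xs ys)) (count-map p (x ,_) ys))
    head-tail : count r (x ∷ xs) * m ≤ count (λ y → p (x , y)) ys + count p (cartesianProduct xs ys)
    head-tail with r x in rx
    ... | true  = +-mono-≤ (h x rx) (count-cartesianProduct-≥ p r m xs ys h)
    ... | false = ≤-trans (count-cartesianProduct-≥ p r m xs ys h) (m≤n+m _ _)

length-cartesianProduct : ∀ (xs : List A) (ys : List B) →
  length (cartesianProduct xs ys) ≡ length xs * length ys
length-cartesianProduct [] ys = refl
length-cartesianProduct (x ∷ xs) ys =
  trans (length-++ (map (x ,_) ys))
        (cong₂ _+_ (length-map (x ,_) ys) (length-cartesianProduct xs ys))

-- Double counting, averaging and greedy covers.

+-interpose : ∀ a b c {d} → a + c ≡ d → a + (b + c) ≡ b + d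
+-interpose a b c refl = x∙yz≈y∙xz a b c

module _ (R : A → B → Bool) where

  -- The induction step of double counting: a new row of the incidence matrix of `R` is spread over
  -- the column counts.
  sum-count-∷ : ∀ x xs ys →
    count (R x) ys + sum (map (λ y → count (λ x → R x y) xs) ys)
      ≡ sum (map (λ y → count (λ x → R x y) (x ∷ xs)) ys)
  sum-count-∷ x xs [] = refl
  sum-count-∷ x xs (y ∷ ys) with R x y
  ... | true  = cong suc (+-interpose (count (R x) ys) (count (λ x → R x y) xs) _ (sum-count-∷ x xs ys))
  ... | false = +-interpose (count (R x) ys) (count (λ x → R x y) xs) _ (sum-count-∷ x xs ys)

  double-count : ∀ d {xs} ys → All (λ x → d ≤ count (R x) ys) xs →
    length xs * d ≤ sum (map (λ y → count (λ x → R x y) xs) ys)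
  double-count d ys [] = z≤n
  double-count d {x ∷ xs} ys (h ∷ hs) =
    ≤-trans (+-mono-≤ h (double-count d ys hs)) (≤-reflexive (sum-count-∷ x xs ys))

average : ∀ (f : A → ℕ) x xs → ∃ λ y → sum (map f (x ∷ xs)) ≤ length (x ∷ xs) * f y
average f x [] = x , ≤-refl
average f x (x′ ∷ xs) with average f x′ xs
... | y , h with ≤-total (f x) (f y)
...   | inj₁ fx≤fy = y , +-mono-≤ fx≤fy h
...   | inj₂ fy≤fx = x , +-monoʳ-≤ (f x) (≤-trans h (*-monoʳ-≤ (length (x′ ∷ xs)) fy≤fx))

-- Each `x` is related to more than a 1/k fraction of `ys`, so on average a `y` is related to at
-- least a 1/k fraction of `xs`. The split on `d` is there because the last step divides by it.
pigeonhole : ∀ (R : A → B → Bool) k d ys → length ys < k * d → B → ∀ {xs} →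
  All (λ x → d ≤ count (R x) ys) xs → ∃ λ y → length xs ≤ k * count (λ x → R x y) xs
pigeonhole R k zero ys lt _ _ = contradiction (≤-trans lt (≤-reflexive (*-zeroʳ k))) λ ()
-- With no columns and `d` positive there can be no rows either; the supplied element of `B` is then
-- the default witness.
pigeonhole R k (suc d) [] lt y [] = y , z≤n
pigeonhole R k (suc d) [] lt y (() ∷ _)
pigeonhole R k (suc d) ys@(y₀ ∷ ys₀) lt _ {xs} hs
  with average (λ y → count (λ x → R x y) xs) y₀ ys₀
... | y , h = y , *-cancelʳ-≤ _ _ (suc d) (begin
    length xs * suc d     ≤⟨ double-count R (suc d) ys hs ⟩
    sum (map (λ y → count (λ x → R x y) xs) ys) ≤⟨ h ⟩
    length ys * c         ≤⟨ *-monoˡ-≤ c (<⇒≤ lt) ⟩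
    k * suc d * c         ≡⟨ xy∙z k (suc d) c ⟩
    k * c * suc d         ∎)
  where
    open ≤-Reasoning
    c = count (λ x → R x y) xs
    xy∙z : ∀ a b c → a * b * c ≡ a * c * b
    xy∙z = solve-∀

avoids : (A → B → Bool) → List B → A → Bool
avoids R Y x = not (any (R x) Y)

-- Greedy covering: the next element of Y meets at least 1/k of the x that Y does
-- not meet yet, and 1 − 1/k ≤ (k + t)/(k + t + 1).
cover : ∀ (R : A → B → Bool) k d ys → length ys < k * d → B → ∀ t xs →
  All (λ x → d ≤ count (R x) ys) xs →
  ∃ λ Y → length Y ≡ t × (k + t) * count (avoids R Y) xs ≤ k * length xs
cover R k d ys lt y₀ zero xs hs = [] , refl , (begin
    (k + 0) * count (λ _ → true) xs ≡⟨ cong (_* count (λ _ → true) xs) (+-identityʳ k) ⟩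
    k * count (λ _ → true) xs       ≤⟨ *-monoʳ-≤ k (length-filter _ xs) ⟩
    k * length xs                   ∎)
  where open ≤-Reasoning
cover R k d ys lt y₀ (suc t) xs hs
  with pigeonhole R k d ys lt y₀ hs
... | y , many
  with cover R k d ys lt y₀ t (filterᵇ (λ x → not (R x y)) xs) (All.filter⁺ _ hs)
... | Y , refl , few = y ∷ Y , refl , (begin
    (k + suc t) * count (avoids R (y ∷ Y)) xs ≤⟨ *-monoʳ-≤ (k + suc t) shrink ⟩
    (k + suc t) * u           ≡⟨ distrib k t u ⟩
    (k + t) * u + u           ≤⟨ +-mono-≤ few (length-filter _ xs′) ⟩
    k * length xs′ + length xs′ ≤⟨ +-monoʳ-≤ (k * length xs′) (≤-trans (length-filter _ xs) many) ⟩
    k * length xs′ + k * h    ≡⟨ *-distribˡ-+ k (length xs′) h ⟨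
    k * (length xs′ + h)      ≡⟨ cong (k *_) (count-not (λ x → R x y) xs) ⟨
    k * length xs             ∎)
  where
    open ≤-Reasoning
    xs′ = filterᵇ (λ x → not (R x y)) xs
    u = count (avoids R Y) xs′
    h = count (λ x → R x y) xs
    deMorgan : ∀ a b → not (a ∨ b) ≡ true → not a ∧ not b ≡ true
    deMorgan false b e = e
    shrink : count (avoids R (y ∷ Y)) xs ≤ u
    shrink = ≤-trans (count-mono (λ x → deMorgan (R x y) (any (R x) Y)) xs)
               (≤-reflexive (sym (count-filterᵇ (avoids R Y) (λ x → not (R x y)) xs)))
    distrib : ∀ a b c → (a + suc b) * c ≡ (a + b) * c + c
    distrib = solve-∀

-- Boolean tests, and vertices outside a finite list.

∧-true : ∀ a b → a ∧ b ≡ true → a ≡ true × b ≡ true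
∧-true true true _ = refl , refl

not-does⇒¬ : ∀ {P : Set} (P? : Dec P) → not (does P?) ≡ true → ¬ P
not-does⇒¬ (no ¬p) _ = ¬p

does-false⇒¬ : ∀ {P : Set} (P? : Dec P) → does P? ≡ false → ¬ P
does-false⇒¬ (no ¬p) _ = ¬p

avoids-false⇒∃ : ∀ (R : A → B → Bool) Y x → avoids R Y x ≡ false → ∃ λ y → y ∈ Y × R x y ≡ true
avoids-false⇒∃ R (y ∷ Y) x e with R x y in Rxy
... | true  = y , here refl , Rxy
... | false with avoids-false⇒∃ R Y x e
...   | y′ , y′∈Y , Rxy′ = y′ , there y′∈Y , Rxy′

module _ {n : ℕ} where

  open DecMembership (_≟_ {n}) using (_∈?_)

  vertices : List (Fin n)
  vertices = allFin n

  length-vertices : length vertices ≡ n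
  length-vertices = length-tabulate {n = n} _

  count-absent : ∀ {u : Fin n} {xs} → All (u ≢_) xs → count (λ v → does (v ≟ u)) xs ≡ 0
  count-absent [] = refl
  count-absent {u} {x ∷ xs} (u≢x ∷ h) with x ≟ u
  ... | yes x≡u = contradiction (sym x≡u) u≢x
  ... | no  _   = count-absent h

  count-unique : ∀ (u : Fin n) {xs} → Unique xs → count (λ v → does (v ≟ u)) xs ≤ 1
  count-unique u [] = z≤n
  count-unique u {x ∷ xs} (h ∷ hs) with x ≟ u
  ... | yes refl = s≤s (≤-reflexive (count-absent h))
  ... | no  _    = count-unique u hs

  -- Only an upper bound, since `U` may list a vertex more than once; `vertices` does not.
  count-∈ : ∀ U → count (λ v → does (v ∈? U)) vertices ≤ length U
  count-∈ [] = ≤-reflexive (count-false vertices)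
    where
      count-false : ∀ (xs : List (Fin n)) → count (λ _ → false) xs ≡ 0
      count-false [] = refl
      count-false (_ ∷ xs) = count-false xs
  count-∈ (u ∷ U) = ≤-trans (count-∨ (λ v → does (v ≟ u)) (λ v → does (v ∈? U)) vertices)
    (+-mono-≤ (count-unique u (allFin⁺ n)) (count-∈ U))

  _∖_ : (Fin n → Bool) → List (Fin n) → Fin n → Bool
  (p ∖ U) v = p v ∧ not (does (v ∈? U))

  ∖-elim : ∀ p U {v} → (p ∖ U) v ≡ true → p v ≡ true × v ∉ U
  ∖-elim p U {v} e with ∧-true (p v) _ e
  ... | pv , v∉U = pv , not-does⇒¬ (v ∈? U) v∉U

  count-∖ : ∀ p U → count p vertices ≤ count (p ∖ U) vertices + length U
  count-∖ p U = ≤-trans (count-mono (λ v → case (p v) (does (v ∈? U))) vertices)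
    (≤-trans (count-∨ (p ∖ U) (λ v → does (v ∈? U)) vertices)
             (+-monoʳ-≤ (count (p ∖ U) vertices) (count-∈ U)))
    where
      case : ∀ a b → a ≡ true → (a ∧ not b) ∨ b ≡ true
      case true true  _ = refl
      case true false _ = refl

  ∃-fresh : ∀ p U → length U < count p vertices → ∃ λ v → p v ≡ true × v ∉ U
  ∃-fresh p U lt with count-<⇒∃ p (λ v → does (v ∈? U)) vertices (≤-<-trans (count-∈ U) lt)
  ... | v , pv , v∉U = v , pv , does-false⇒¬ (v ∈? U) v∉U

-- Sequences of disjoint pairs and their cyclic indexing.

Pair : ℕ → Set
Pair n = Fin 2 → Fin n

⟨_,_⟩ : ∀ {n} → Fin n → Fin n → Pair n
⟨ a , b ⟩ zero       = a
⟨ a , b ⟩ (suc zero) = b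

-- A sequence of pairs is a curried map on the vertices of a zycle, and this is its injectivity: the
-- pairs are disjoint and each has two vertices.
InjectivePairs : ∀ {n m} → (Fin m → Pair n) → Set
InjectivePairs g = ∀ {i j i′ j′} → g i j ≡ g i′ j′ → (i , j) ≡ (i′ , j′)

pair-injective : ∀ {n} {Q : Pair n} → Q zero ≢ Q (suc zero) → ∀ {j j′} → Q j ≡ Q j′ → j ≡ j′
pair-injective Q₀≢Q₁ {zero}     {zero}     _ = refl
pair-injective Q₀≢Q₁ {zero}     {suc zero} e = contradiction e Q₀≢Q₁
pair-injective Q₀≢Q₁ {suc zero} {zero}     e = contradiction (sym e) Q₀≢Q₁
pair-injective Q₀≢Q₁ {suc zero} {suc zero} _ = refl

∷-injectivePairs : ∀ {n m} {Q : Pair n} {g : Fin m → Pair n} → Q zero ≢ Q (suc zero) →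
  (∀ j i j′ → Q j ≢ g i j′) → InjectivePairs g → InjectivePairs (Q ∷ᶠ g)
∷-injectivePairs Q₀≢Q₁ fresh inj {zero}  {j} {zero}   {j′} e = cong (zero ,_) (pair-injective Q₀≢Q₁ e)
∷-injectivePairs Q₀≢Q₁ fresh inj {zero}  {j} {suc i′} {j′} e = contradiction e (fresh j i′ j′)
∷-injectivePairs Q₀≢Q₁ fresh inj {suc i} {j} {zero}   {j′} e = contradiction (sym e) (fresh j′ i j)
∷-injectivePairs Q₀≢Q₁ fresh inj {suc i} {j} {suc i′} {j′} e with inj e
... | refl = refl

-- The i-th pair of the zycle sits at position previous i of the walk, so that the
-- closing step of the walk leaves the zycle's pair 0, where the edge was deleted.
previous : ∀ {m} → Fin (suc m) → Fin (suc m)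
previous {m} zero = fromℕ m
previous (suc i)  = inject₁ i

next-fromℕ : ∀ m → next (fromℕ m) ≡ zero
next-fromℕ m = toℕ-injective (trans (toℕ-fromℕ< (m%n<n (suc (toℕ (fromℕ m))) (suc m)))
  (trans (cong (λ j → suc j % suc m) (toℕ-fromℕ m)) (n%n≡0 (suc m))))

next-inject₁ : ∀ {m} (i : Fin m) → next (inject₁ i) ≡ suc i
next-inject₁ {m} i = toℕ-injective (trans (toℕ-fromℕ< (m%n<n (suc (toℕ (inject₁ i))) (suc m)))
  (trans (cong (λ j → suc j % suc m) (toℕ-inject₁ i)) (m<n⇒m%n≡m (s≤s (toℕ<n i)))))

-- Makes `previous` injective, and so the vertex map of the copy. The converse identity turns steps
-- of the zycle into steps of the walk.
next-previous : ∀ {m} (i : Fin (suc m)) → next (previous i) ≡ i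
next-previous {m} zero = next-fromℕ m
next-previous (suc i)  = next-inject₁ i

previous-next : ∀ {m} (i : Fin (suc m)) → previous (next i) ≡ i
previous-next i with view i
... | ‵fromℕ     = cong previous (next-fromℕ _)
... | ‵inject₁ i = cong previous (next-inject₁ i)

-- Walks of pairs and copies of the zycle minus an edge.

module _ {n : ℕ} (H : ThreeGraph n) where

  edge-≢₁₂ : ∀ {x y z} → edge H x y z ≡ true → x ≢ y
  edge-≢₁₂ {x} {y} {z} e x≡y = contradiction (trans (sym e) (distinct H x y z x≡y)) λ ()

  edge-swap₁₂ : ∀ {x y z} → edge H x y z ≡ true → edge H y x z ≡ true
  edge-swap₁₂ = trans (sym (swap₁₂ H _ _ _))

  edge-swap₂₃ : ∀ {x y z} → edge H x y z ≡ true → edge H x z y ≡ true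
  edge-swap₂₃ = trans (sym (swap₂₃ H _ _ _))

  edge-≢₁₃ : ∀ {x y z} → edge H x y z ≡ true → x ≢ z
  edge-≢₁₃ = edge-≢₁₂ ∘ edge-swap₂₃

  edge-≢₂₃ : ∀ {x y z} → edge H x y z ≡ true → y ≢ z
  edge-≢₂₃ = edge-≢₁₃ ∘ edge-swap₁₂

  _⇒_ : Pair n → Pair n → Set
  P ⇒ Q = ∀ j → edge H (P zero) (P (suc zero)) (Q j) ≡ true

  IsWalk : ∀ {m} → (Fin (suc m) → Pair n) → Set
  IsWalk g = ∀ i → g (inject₁ i) ⇒ g (suc i)

  ∷-isWalk : ∀ {m} {Q : Pair n} {g : Fin (suc m) → Pair n} → Q ⇒ g zero → IsWalk g → IsWalk (Q ∷ᶠ g)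
  ∷-isWalk start walk zero    = start
  ∷-isWalk start walk (suc i) = walk i

  -- The return from the last pair to the first needs just one edge, because the other one is the
  -- deleted edge. The edge kept ends in entry `suc zero` of the first pair.
  closed-walk⇒zycle : ∀ r (g : Fin (3 + r) → Pair n) → InjectivePairs g → IsWalk g →
    edge H (g (fromℕ _) zero) (g (fromℕ _) (suc zero)) (g zero (suc zero)) ≡ true →
    ContainsZycleMinus (3 + r) H
  closed-walk⇒zycle r g inj walk close = φ , φ-injective , φ-edge
    where
      φ : ZVertex (3 + r) → Fin n
      φ (i , j) = g (previous i) j

      φ-injective : Injective _≡_ _≡_ φ
      φ-injective {i , j} {i′ , j′} e with inj {previous i} {j} {previous i′} {j′} e
      ... | e′ = cong₂ _,_
        (trans (sym (next-previous i)) (trans (cong (next ∘ proj₁) e′) (next-previous i′)))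
        (cong proj₂ e′)

      φ-edge : ∀ i j → ¬ IsDeletedEdge i j →
        edge H (φ (i , zero)) (φ (i , suc zero)) (φ (next i , j)) ≡ true
      φ-edge i j kept rewrite previous-next i with i | j
      ... | zero   | zero     = contradiction (refl , refl) kept
      ... | zero   | suc zero = close
      ... | suc i′ | j′       = walk i′ j′

  meets : Fin n × Fin n → Fin n → Bool
  meets (a , b) = edge H a b

  Hit : List (Fin n) → Pair n → Set
  Hit Y Q = ∃ λ y → y ∈ Y × edge H (Q zero) (Q (suc zero)) y ≡ true

  -- `U` stands for the vertices already used; fixing the bound `s` in advance lets one set `Y`
  -- serve the whole walk.
  Extendable : List (Fin n) → ℕ → Set
  Extendable Y s = ∀ P → P zero ≢ P (suc zero) → ∀ U → length U ≤ s →
    ∃ λ Q → Q zero ≢ Q (suc zero) × P ⇒ Q × (∀ j → Q j ∉ U) × Hit Y Q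

  -- Every chosen pair joins `U`, which keeps the pairs disjoint. When the last of the `suc r` pairs
  -- is chosen, `r * 2` vertices have been added, whence the budget.
  extend : ∀ {Y s} → Extendable Y s → ∀ r P → P zero ≢ P (suc zero) → ∀ U → length U + r * 2 ≤ s →
    ∃ λ (g : Fin (suc r) → Pair n) →
      P ⇒ g zero × IsWalk g × InjectivePairs g × (∀ i j → g i j ∉ U) × Hit Y (g (fromℕ r))
  extend ext zero P P₀≢P₁ U len
    with ext P P₀≢P₁ U (≤-trans (m≤m+n _ _) len)
  ... | Q , Q₀≢Q₁ , P⇒Q , fresh , hit =
    (λ _ → Q) , P⇒Q , (λ ()) ,
    (λ { {zero} {_} {zero} e → cong (zero ,_) (pair-injective Q₀≢Q₁ e) }) ,
    (λ _ → fresh) , hit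
  extend ext (suc r) P P₀≢P₁ U len
    with ext P P₀≢P₁ U (≤-trans (m≤m+n _ _) len)
  ... | Q , Q₀≢Q₁ , P⇒Q , fresh , _
    with extend ext r Q Q₀≢Q₁ (Q zero ∷ Q (suc zero) ∷ U) (≤-trans (≤-reflexive (shift (length U) (r * 2))) len)
    where
      shift : ∀ a b → 2 + a + b ≡ a + (2 + b)
      shift = solve-∀
  ... | g , start , walk , inj , fresh′ , hit =
    (Q ∷ᶠ g) , P⇒Q , ∷-isWalk start walk , ∷-injectivePairs Q₀≢Q₁ Q∉g inj ,
    (λ { zero → fresh ; (suc i) j → fresh′ i j ∘ there ∘ there }) , hit
    where
      Q∉g : ∀ j i j′ → Q j ≢ g i j′
      Q∉g zero       i j′ e = fresh′ i j′ (here (sym e))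
      Q∉g (suc zero) i j′ e = fresh′ i j′ (there (here (sym e)))

  -- Which `y` closes the walk is known only after the last pair is chosen, so the walk avoids all
  -- `t` vertices y and all `t` vertices z of `ws` from the start, together with `c` and `e`.
  reservoir∧extendable⇒zycle : ∀ {t} r (S : Fin n → Bool) ws → length ws ≡ t → 2 ≤ count S vertices →
    All (λ (y , z) → ∀ c → S c ≡ true → edge H y z c ≡ true) ws →
    Extendable (map proj₁ ws) (2 + (t + t) + r * 2) → ContainsZycleMinus (3 + r) H
  reservoir∧extendable⇒zycle r S ws refl large h ext
    with ∃-fresh S [] (≤-trans (s≤s z≤n) large)
  ... | c , Sc , _
    with ∃-fresh S (c ∷ []) large
  ... | e , Se , e∉c
    with extend ext r ⟨ c , e ⟩ (λ c≡e → e∉c (here (sym c≡e)))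
           (c ∷ e ∷ map proj₁ ws ++ map proj₂ ws) (≤-reflexive (cong (λ l → 2 + l + r * 2) |ws|))
    where
      |ws| : length (map proj₁ ws ++ map proj₂ ws) ≡ length ws + length ws
      |ws| = trans (length-++ (map proj₁ ws)) (cong₂ _+_ (length-map proj₁ ws) (length-map proj₂ ws))
  ... | g , start , walk , inj , fresh , (y , y∈Y , closing)
    with ∈-map⁻ proj₁ y∈Y
  ... | (y , z) , w∈ws , refl =
    -- `y` is put second because the closing edge has to end in entry `suc zero`.
    closed-walk⇒zycle r (⟨ z , y ⟩ ∷ᶠ (⟨ c , e ⟩ ∷ᶠ g))
      (∷-injectivePairs (edge-≢₁₂ zyc) zy∉ (∷-injectivePairs (λ c≡e → e∉c (here (sym c≡e))) ce∉g inj))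
      (∷-isWalk (λ { zero → zyc ; (suc zero) → zye }) (∷-isWalk start walk))
      closing
    where
      zyc : edge H z y c ≡ true
      zyc = edge-swap₁₂ (All.lookup h w∈ws c Sc)
      zye : edge H z y e ≡ true
      zye = edge-swap₁₂ (All.lookup h w∈ws e Se)
      ce∉g : ∀ j i j′ → ⟨ c , e ⟩ j ≢ g i j′
      ce∉g zero       i j′ eq = fresh i j′ (here (sym eq))
      ce∉g (suc zero) i j′ eq = fresh i j′ (there (here (sym eq)))
      zy∉ : ∀ j i j′ → ⟨ z , y ⟩ j ≢ (⟨ c , e ⟩ ∷ᶠ g) i j′
      -- `c` and `e` were not chosen to avoid `z` and `y`; they differ from them as vertices of
      -- common edges.
      zy∉ zero       zero    zero       = edge-≢₁₃ zyc
      zy∉ zero       zero    (suc zero) = edge-≢₁₃ zye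
      zy∉ (suc zero) zero    zero       = edge-≢₂₃ zyc
      zy∉ (suc zero) zero    (suc zero) = edge-≢₂₃ zye
      zy∉ zero       (suc i) j′ eq = fresh i j′ (there (there
        (∈-++⁺ʳ (map proj₁ ws) (subst (_∈ map proj₂ ws) eq (∈-map⁺ proj₂ w∈ws)))))
      zy∉ (suc zero) (suc i) j′ eq = fresh i j′ (there (there
        (∈-++⁺ˡ (subst (_∈ map proj₁ ws) eq (∈-map⁺ proj₁ w∈ws)))))

-- Sizes of the hitting set and of the reservoir.

hittingSize : ℕ → ℕ
hittingSize k = 4 * (k * k * k)

-- Here `u` counts the pairs whose neighbourhood misses the hitting set. Since d ≤ 2m, we have n <
-- 2km, while `u` is at most kn²/(k + 4k³) ≤ n²/(4k²). The size 4k³ is what brings this below m².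
few-avoided : ∀ k n d m s u → n < k * d → d ≤ 1 + m + s → 2 + 2 * s ≤ d →
  (k + hittingSize k) * u ≤ k * (n * n) → u < m * m
few-avoided zero n d m s u () _ _ _
few-avoided k@(suc _) n d m s u n<kd d≤ s≤ few = ≰⇒> λ m²≤u → <-irrefl refl (begin-strict
    k * (n * n)                   <⟨ *-monoʳ-< k (*-mono-< n<kd n<kd) ⟩
    k * ((k * d) * (k * d))       ≤⟨ *-monoʳ-≤ k (*-mono-≤ (*-monoʳ-≤ k d≤2m) (*-monoʳ-≤ k d≤2m)) ⟩
    k * ((k * (2 * m)) * (k * (2 * m))) ≡⟨ collect k m ⟩
    4 * (k * k * k) * (m * m)     ≤⟨ *-monoʳ-≤ (4 * (k * k * k)) m²≤u ⟩
    4 * (k * k * k) * u           ≤⟨ *-monoˡ-≤ u (m≤n+m _ k) ⟩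
    (k + 4 * (k * k * k)) * u     ≤⟨ few ⟩
    k * (n * n)                   ∎)
  where
    open ≤-Reasoning
    collect : ∀ k m → k * ((k * (2 * m)) * (k * (2 * m))) ≡ 4 * (k * k * k) * (m * m)
    collect = solve-∀
    double : ∀ m s → 2 * (1 + m + s) ≡ 2 * m + (2 + 2 * s)
    double = solve-∀
    -- The loss `1 + s` is at most half of `d`: double the bound on `d` and cancel one `d`.
    d≤2m : d ≤ 2 * m
    d≤2m = +-cancelʳ-≤ d d (2 * m) (begin
      d + d                 ≡⟨ cong (d +_) (+-identityʳ d) ⟨
      2 * d                 ≤⟨ *-monoʳ-≤ 2 d≤ ⟩
      2 * (1 + m + s)       ≡⟨ double m s ⟩
      2 * m + (2 + 2 * s)   ≤⟨ +-monoʳ-≤ (2 * m) s≤ ⟩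
      2 * m + d             ∎)

-- The hypothesis `n < k * d` serves as the proof that `k` is positive.
*-cancelˡ-≤-pos : ∀ k d {n a b} → n < k * d → k * a ≤ k * b → a ≤ b
*-cancelˡ-≤-pos (suc k) d _ = *-cancelˡ-≤ (suc k)

-- The number of vertices needed at the outset to keep `m` after `t` rounds: a round sets one vertex
-- aside and keeps at least a 1/k fraction of the rest.
reservoirSize : ℕ → ℕ → ℕ → ℕ
reservoirSize k m zero    = m
reservoirSize k m (suc t) = reservoirSize k (1 + k * m) t

-- Reservoir and hitting set under a codegree condition.

module _ {n : ℕ} (H : ThreeGraph n) (k d : ℕ) (n<kd : n < k * d) (δ : MinCodegreeAtLeast H d) where

  n<kd′ : length (vertices {n}) < k * d
  n<kd′ = subst (_< k * d) (sym length-vertices) n<kd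

  d≤degree : ∀ {x y} → x ≢ y → d ≤ count (edge H x y) vertices
  d≤degree {x} {y} x≢y = ≤-trans (δ x y x≢y)
    (length-filter≤count _ (edge H x y) (λ { (_ , _ , e) → e }) vertices)

  reservoir : Fin n → ∀ Y m → reservoirSize k m (length Y) ≤ n →
    ∃₂ λ (S : Fin n → Bool) (ws : List (Fin n × Fin n)) →
      m ≤ count S vertices × map proj₁ ws ≡ Y ×
      All (λ (y , z) → ∀ c → S c ≡ true → edge H y z c ≡ true) ws
  reservoir v₀ [] m m≤n = (λ _ → true) , [] ,
    ≤-trans m≤n (≤-reflexive (trans (sym length-vertices) (sym (count-true vertices)))) , refl , []
    where
      count-true : ∀ (xs : List (Fin n)) → count (λ _ → true) xs ≡ length xs
      count-true [] = refl
      count-true (_ ∷ xs) = cong suc (count-true xs)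
  reservoir v₀ (y ∷ Y) m size
    with reservoir v₀ Y (1 + k * m) size
  ... | S , ws , large , refl , h
    -- Each `c` in `S` other than `y` spans with `y` a pair of codegree at least `d`, so a single
    -- `z` completes an edge with `y` and at least a 1/k fraction of these `c`.
    with pigeonhole (edge H y) k d vertices n<kd′ v₀ {filterᵇ (S ∖ (y ∷ [])) vertices}
           (All.map (λ {c} e → d≤degree λ y≡c →
                      proj₂ (∖-elim S (y ∷ []) (Equivalence.to T-≡ e)) (here (sym y≡c)))
                    (All.all-filter (T? ∘ (S ∖ (y ∷ []))) vertices))
  ... | z , many = S′ , (y , z) ∷ ws , *-cancelˡ-≤-pos k d n<kd m≤ , refl ,
          (λ c e → edge-swap₂₃ H (proj₂ (∧-true _ _ e))) ∷
          All.map (λ f c e → f c (proj₁ (∖-elim S (y ∷ []) (proj₁ (∧-true _ _ e))))) h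
    where
      open ≤-Reasoning
      S′ : Fin n → Bool
      S′ c = (S ∖ (y ∷ [])) c ∧ edge H y c z
      m≤ : k * m ≤ k * count S′ vertices
      m≤ = begin
        k * m ≤⟨ +-cancelʳ-≤ 1 (k * m) _ (begin
          k * m + 1 ≡⟨ +-comm (k * m) 1 ⟩
          1 + k * m ≤⟨ large ⟩
          count S vertices ≤⟨ count-∖ S (y ∷ []) ⟩
          count (S ∖ (y ∷ [])) vertices + 1 ∎) ⟩
        count (S ∖ (y ∷ [])) vertices ≤⟨ many ⟩
        k * count (λ c → edge H y c z) (filterᵇ (S ∖ (y ∷ [])) vertices)
          ≡⟨ cong (k *_) (count-filterᵇ (λ c → edge H y c z) (S ∖ (y ∷ [])) vertices) ⟩
        k * count S′ vertices ∎

  private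
    t : ℕ
    t = hittingSize k

  ordered-pairs : List (Fin n × Fin n)
  ordered-pairs = cartesianProduct vertices vertices

  length-ordered-pairs : length ordered-pairs ≡ n * n
  length-ordered-pairs = trans (length-cartesianProduct (vertices {n}) (vertices {n}))
    (cong₂ _*_ (length-vertices {n}) (length-vertices {n}))

  -- Phrased as membership in a singleton so that it is literally the second factor of
  -- `N ∖ (a ∷ [])` below.
  off-diagonal : Fin n × Fin n → Bool
  off-diagonal (a , b) = not (does (b ∈? (a ∷ [])))
    where open DecMembership (_≟_ {n}) using (_∈?_)

  -- The greedy cover is applied to ordered pairs of distinct vertices, related to the vertices of
  -- their neighbourhoods. So few pairs avoid `Y` that they cannot fill the part of a neighbourhood
  -- left by `U`.
  ∃-hitting : Fin n → ∃ λ Y → length Y ≡ t × (∀ s → 2 + 2 * s ≤ d → Extendable H Y s)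
  ∃-hitting v₀
    with cover (meets H) k d vertices n<kd′ v₀ t (filterᵇ off-diagonal ordered-pairs)
           (All.map (λ { {a , b} e → d≤degree λ a≡b →
                       not-does⇒¬ (b ∈? (a ∷ [])) (Equivalence.to T-≡ e) (here (sym a≡b)) })
                    (All.all-filter (T? ∘ off-diagonal) ordered-pairs))
    where open DecMembership (_≟_ {n}) using (_∈?_)
  ... | Y , |Y|≡t , few = Y , |Y|≡t , extendable
    where
      open DecMembership (_≟_ {n}) using (_∈?_)

      avoided : Fin n × Fin n → Bool
      avoided x = off-diagonal x ∧ avoids (meets H) Y x

      few′ : (k + t) * count avoided ordered-pairs ≤ k * (n * n)
      few′ = begin
        (k + t) * count avoided ordered-pairs
          ≡⟨ cong ((k + t) *_) (count-filterᵇ (avoids (meets H) Y) off-diagonal ordered-pairs) ⟨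
        (k + t) * count (avoids (meets H) Y) (filterᵇ off-diagonal ordered-pairs) ≤⟨ few ⟩
        k * length (filterᵇ off-diagonal ordered-pairs) ≤⟨ *-monoʳ-≤ k (length-filter _ ordered-pairs) ⟩
        k * length ordered-pairs ≡⟨ cong (k *_) length-ordered-pairs ⟩
        k * (n * n) ∎
        where open ≤-Reasoning

      extendable : ∀ s → 2 + 2 * s ≤ d → Extendable H Y s
      extendable s s≤d P P₀≢P₁ U |U|≤s = found
        where
          open ≤-Reasoning
          N : Fin n → Bool
          N = edge H (P zero) (P (suc zero)) ∖ U
          within : Fin n × Fin n → Bool
          within (a , b) = N a ∧ (N ∖ (a ∷ [])) b
          -- For each `a` in `N`, at least `m` vertices of `N` other than `a` can serve as `b`.
          -- Truncation is harmless, as `count N vertices ≤ 1 + m` still holds.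
          m = count N vertices ∸ 1
          d≤ : d ≤ 1 + m + s
          d≤ = begin
            d ≤⟨ d≤degree P₀≢P₁ ⟩
            count (edge H (P zero) (P (suc zero))) vertices ≤⟨ count-∖ _ U ⟩
            count N vertices + length U ≤⟨ +-mono-≤ (m≤n+m∸n (count N vertices) 1) |U|≤s ⟩
            1 + m + s ∎
          row : ∀ a → N a ≡ true → m ≤ count (λ b → within (a , b)) vertices
          row a Na rewrite Na = m≤n+o⇒m∸n≤o (count N vertices) 1
            (≤-trans (count-∖ N (a ∷ [])) (≤-reflexive (+-comm _ 1)))
          found : ∃ λ Q → Q zero ≢ Q (suc zero) × _⇒_ H P Q × (∀ j → Q j ∉ U) × Hit H Y Q
          -- Fewer than m² pairs are avoided, but at least m² lie within `N`.
          found with count-<⇒∃ within avoided ordered-pairs (begin-strict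
                  count avoided ordered-pairs <⟨ few-avoided k n d m s _ n<kd d≤ s≤d few′ ⟩
                  m * m ≤⟨ *-monoˡ-≤ m (m∸n≤m (count N vertices) 1) ⟩
                  count N vertices * m ≤⟨ count-cartesianProduct-≥ within N m vertices vertices row ⟩
                  count within ordered-pairs ∎)
          ... | (a , b) , w , av with ∧-true (N a) _ w
          ... | Na , Nb∖a with ∧-true (N b) _ Nb∖a
          ... | Nb , b∉a with ∖-elim (edge H (P zero) (P (suc zero))) U Na | ∖-elim (edge H (P zero) (P (suc zero))) U Nb
          ... | Pa , a∉U | Pb , b∉U =
            ⟨ a , b ⟩ ,
            (λ a≡b → not-does⇒¬ (b ∈? (a ∷ [])) b∉a (here (sym a≡b))) ,
            (λ { zero → Pa ; (suc zero) → Pb }) ,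
            (λ { zero → a∉U ; (suc zero) → b∉U }) ,
            -- `av` refutes a conjunction whose first factor holds by `b∉a`, so the second one
            -- fails.
            avoids-false⇒∃ (meets H) Y (a , b)
              (trans (cong (_∧ avoids (meets H) Y (a , b)) (sym b∉a)) av)

  contains-zycle : ∀ r → 2 + 2 * (2 + (t + t) + r * 2) ≤ d → reservoirSize k 2 t ≤ n → Fin n →
    ContainsZycleMinus (3 + r) H
  contains-zycle r s≤d size v₀ =
    let Y , |Y|≡t , extendable = ∃-hitting v₀
        S , ws , large , ws≡Y , h = reservoir v₀ Y 2 (subst (λ l → reservoirSize k 2 l ≤ n) (sym |Y|≡t) size)
    in reservoir∧extendable⇒zycle H r S ws
         (trans (sym (length-map proj₁ ws)) (trans (cong length ws≡Y) |Y|≡t)) large h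
         (subst (λ Y → Extendable H Y _) (sym ws≡Y) (extendable _ s≤d))

theorem1p5 : (ℓ : ℕ) → 3 ≤ ℓ → (k : ℕ) → 1 ≤ k →
    ∃ λ (N : ℕ) → (n : ℕ) → N ≤ n → (H : ThreeGraph n) → ¬ ContainsZycleMinus ℓ H →
      (d : ℕ) → MinCodegreeAtLeast H d → k * d ≤ n
theorem1p5 (suc (suc (suc r))) (s≤s (s≤s (s≤s z≤n))) k _ =
  -- As `k` is arbitrary, the bound for all large `n` puts γ below every 1/k. The first summand
  -- feeds the reservoir, which must keep two vertices; the second makes `k * degree ≤ n < k * d`
  -- force `degree < d`; the `suc` provides the default vertex `zero`.
  suc (reservoirSize k 2 t + k * degree) , λ
    { (suc n) (s≤s N≤n) H free d δ → ≮⇒≥ λ n<kd →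
        free (contains-zycle H k d n<kd δ r
          (<⇒≤ (*-cancelˡ-< k degree d (≤-<-trans (m≤n⇒m≤1+n (m+n≤o⇒n≤o _ N≤n)) n<kd)))
          (m≤n⇒m≤1+n (m+n≤o⇒m≤o _ N≤n)) zero) }
  where
    t = hittingSize k
    degree = 2 + 2 * (2 + (t + t) + r * 2)
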